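{- Let $k,n,L$ be positive integers with $2k<n$, let $q$ be a prime power, and let $\mathcal{F}$ be an $[n,k,L]_q$-AAD family. Then $$|\mathcal{F}|\le 1+L\,\frac{q^{n-k}-1}{q^k-1}.$$ Consequently, if $L=L(q)$ is a positive-integer-valued function of $q$ with $L=q^{o(1)}$ as $q\to\infty$ (in particular if $L$ is constant), then $p^{AS}(n,k,L)\le n-2k$.
   Context: Let $q$ be a prime power and $\mathbb{F}_q$ the field with $q$ elements. A partial $k$-spread in $\mathbb{F}_q^n$ is a collection of $k$-dimensional linear subspaces with pairwise trivial intersection (i.e. equal to $\{0\}$). For $u\in\mathbb{F}_q^n$ and a subspace $S$, $u+S=\{u+v: v\in S\}$. For positive integers $k,n$ with $2k<n$, a family $\mathcal{F}$ of $k$-dimensional linear subspaces of $\mathbb{F}_q^n$ is $L$-almost affinely disjoint, written $[n,k,L]_q$-AAD, if (1) $\mathcal{F}$ is a partial $k$-spread of $\mathbb{F}_q^n$, and (2) for every $S\in\mathcal{F}$ and every $u\in\mathbb{F}_q^n\setminus S$, the affine subspace $u+S$ intersects (has nonempty intersection with) at most $L$ subspaces from $\mathcal{F}$. A family $\mathcal{F}$ of $k$-dimensional linear subspaces of $\mathbb{F}_q^n$ is $L$-almost sparse, written $[n,k,L]_q$-AS, if (1) $\mathcal{F}$ is a partial $k$-spread of $\mathbb{F}_q^n$, and (2) every $(k+1)$-dimensional linear subspace of $\mathbb{F}_q^n$ intersects non-trivially (in more than $\{0\}$) at most $L$ subspaces from $\mathcal{F}$. $m^{AS}_q(n,k,L)$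 denotes the maximal cardinality of an $[n,k,L]_q$-AS family, and $$p^{AS}(n,k,L):=\limsup_{q\to\infty}\log_q\big(m^{AS}_q(n,k,L)\big),$$ with $q$ ranging over prime powers (when $L$ depends on $q$, the value $L(q)$ is used inside the limsup). -}

module Defs where

open import Algebra.Apartness.Bundles using (HeytingField; HeytingCommutativeRing)
open import Algebra.Bundles using (CommutativeRing)
import Algebra.Properties.Semiring.Sum as SemiringSum
open import Data.Fin.Base as Fin using (Fin; zero; suc; funToFin; finToFun)
import Data.Fin.Properties as Fin
open import Data.Fin.Subset as Subset using (∣_∣) renaming (_∈_ to _∈ˢ_)
import Data.Fin.Subset.Properties as Subset
open import Data.Integer.Base using (+_; -[1+_])
open import Data.Nat.Base as ℕ using (ℕ; zero; suc; _^_; _∸_; _≤_; NonZero; z≤n)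
import Data.Nat.Properties as ℕ
open import Data.Nat.Primality using (Prime; prime⇒nonTrivial)
open import Data.Product.Base using (Σ; ∃; ∃-syntax; ∃₂; _×_; _,_; proj₁; proj₂)
open import Data.Rational.Base using (ℚ; mkℚ; 0ℚ; -_) renaming (_<_ to _<ℚ_)
import Data.Rational.Properties as ℚ
import Data.Vec.Base as Vec
open import Data.Vec.Functional as Vector using (Vector)
import Data.Vec.Functional.Relation.Binary.Equality.Setoid as VectorEquality
open import Function.Base using (_∘_)
open import Function.Bundles using (Inverse)
open import Level using (0ℓ; Setω; Lift; lift) renaming (suc to lsuc)
open import Relation.Binary.Bundles using (Setoid)
open import Relation.Binary.Definitions using () renaming (Decidable to Decidable₂)
open import Relation.Binary.PropositionalEquality.Core using (_≡_; _≢_; refl; cong)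
import Relation.Binary.PropositionalEquality as ≡
open import Relation.Nullary using (¬_; Dec; yes; no)
open import Relation.Nullary.Decidable using (map′; ¬?; _×-dec_; _→-dec_; decidable-stable)
open import Relation.Unary using (Pred; Decidable; _∈_; _∉_; _≬_)

IsPrimePower : ℕ → Set
IsPrimePower q = ∃₂ λ p e → Prime p × 1 ≤ e × q ≡ p ^ e

private
  1<m^n : ∀ {m n} → 1 ℕ.< m → 1 ≤ n → 1 ℕ.< m ^ n
  1<m^n {m} {suc n} 1<m _ =
    ℕ.<-≤-trans 1<m (ℕ.m≤m*n m (m ^ n) {{ℕ.m^n≢0 m n {{ℕ.>-nonZero (ℕ.<⇒≤ 1<m)}}}})

q^k∸1≢0 : ∀ {q} → IsPrimePower q → ∀ k .{{_ : NonZero k}} → NonZero (q ^ k ∸ 1)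
q^k∸1≢0 (p , e , p-prime , 1≤e , refl) k =
  ℕ.>-nonZero (ℕ.m<n⇒0<n∸m
    (1<m^n (1<m^n (ℕ.nonTrivial⇒n>1 p {{prime⇒nonTrivial p-prime}}) 1≤e) (ℕ.>-nonZero⁻¹ k)))

-- Being in bijection with Fin q makes equality and invertibility
-- decidable, so a Heyting field of this kind is a field in the usual sense.
record FiniteField (q : ℕ) : Set₁ where
  field
    heytingField : HeytingField 0ℓ 0ℓ 0ℓ

  open HeytingField heytingField public

  field
    enumeration : Inverse setoid (≡.setoid (Fin q))

AtMost : ∀ {p N} → ℕ → Pred (Fin N) p → Set p
AtMost {N = N} L P = ∀ (X : Subset.Subset N) → (∀ {i} → i ∈ˢ X → P i) → ∣ X ∣ ≤ L

IsMaximum : ∀ {p} → Pred ℕ p → Pred ℕ p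
IsMaximum P m = P m × (∀ N → P N → N ≤ m)

module Families {q : ℕ} (F : FiniteField q) where

  open FiniteField F using (Carrier; _≈_; 0#; 1#; setoid; heytingCommutativeRing)
    renaming (_+_ to _+ᶠ_; _*_ to _*ᶠ_) public

  module K = CommutativeRing (HeytingCommutativeRing.commutativeRing heytingCommutativeRing)

  open SemiringSum K.semiring using (sum; sum-cong-≋; ∑-distrib-+; *-distribˡ-sum; sum-replicate-zero)
  open VectorEquality setoid using (_≋_; ≋-refl; ≋-sym; ≋-trans; ≋-setoid) public

  Space : ℕ → Set
  Space n = Vector Carrier n

  0ᵛ : ∀ {n} → Space n
  0ᵛ _ = 0#

  infixl 6 _+ᵛ_
  infixr 7 _*ᵛ_

  _+ᵛ_ : ∀ {n} → Space n → Space n → Space n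
  (x +ᵛ y) i = x i +ᶠ y i

  _*ᵛ_ : ∀ {n} → Carrier → Space n → Space n
  (a *ᵛ x) i = a *ᶠ x i

  combination : ∀ {n k} → Vector Carrier k → Vector (Space n) k → Space n
  combination c b j = sum (λ i → c i *ᶠ b i j)

  LinearlyIndependent : ∀ {n k} → Vector (Space n) k → Set
  LinearlyIndependent b = ∀ c → combination c b ≋ 0ᵛ → c ≋ 0ᵛ

  record LinearSubspace (n : ℕ) : Set₁ where
    field
      Member   : Pred (Space n) 0ℓ
      respects : ∀ {x y} → x ≋ y → x ∈ Member → y ∈ Member
      0-closed : 0ᵛ ∈ Member
      +-closed : ∀ {x y} → x ∈ Member → y ∈ Member → x +ᵛ y ∈ Member
      *-closed : ∀ a {x} → x ∈ Member → a *ᵛ x ∈ Member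

  record Subspace (n k : ℕ) : Set₁ where
    field
      linearSubspace : LinearSubspace n

    open LinearSubspace linearSubspace public

    field
      basis       : Vector (Space n) k
      basis-∈     : ∀ i → basis i ∈ Member
      independent : LinearlyIndependent basis
      spanning    : ∀ {x} → x ∈ Member → ∃[ c ] combination c basis ≋ x

  open Subspace using (Member)

  TrivialIntersection : ∀ {n k l} → Subspace n k → Subspace n l → Set
  TrivialIntersection S T = ∀ x → x ∈ Member S → x ∈ Member T → x ≋ 0ᵛ

  MeetsNontrivially : ∀ {n k l} → Subspace n k → Subspace n l → Set
  MeetsNontrivially S T = ∃[ x ] x ∈ Member S × x ∈ Member T × ¬ x ≋ 0ᵛ

  Translate : ∀ {n k} → Space n → Subspace n k → Pred (Space n) 0ℓ
  Translate u S x = ∃[ v ] v ∈ Member S × x ≋ u +ᵛ v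

  -- For k ≥ 1 the members of a partial spread are distinct (distinct
  -- indices give subspaces with trivial intersection), so an indexed
  -- partial spread over Fin N is the same as a set of cardinality N.
  Family : (n k N : ℕ) → Set₁
  Family n k N = Fin N → Subspace n k

  IsPartialSpread : ∀ {n k N} → Family n k N → Set
  IsPartialSpread 𝓕 = ∀ i j → i ≢ j → TrivialIntersection (𝓕 i) (𝓕 j)

  IsAAD : ∀ {n k N} → ℕ → Family n k N → Set
  IsAAD L 𝓕 = IsPartialSpread 𝓕
    × (∀ i u → u ∉ Member (𝓕 i) → AtMost L (λ j → Translate u (𝓕 i) ≬ Member (𝓕 j)))

  IsAS : ∀ {n k N} → ℕ → Family n k N → Set₁
  IsAS {n} {k} L 𝓕 = IsPartialSpread 𝓕
    × (∀ (U : Subspace n (suc k)) → AtMost L (λ j → MeetsNontrivially U (𝓕 j)))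

  IsASCardinality : (n k L : ℕ) → Pred ℕ (lsuc 0ℓ)
  IsASCardinality n k L N = Σ (Family n k N) (IsAS L)

  -- The maximal cardinality of an AS family exists: cardinalities are
  -- bounded by q ^ n, and being a cardinality is decidable because
  -- families can be replaced by families of bases, of which there are
  -- finitely many.

  Searchable : ∀ {a ℓ} → Setoid a ℓ → Setω
  Searchable S = ∀ {p} {P : Pred (Setoid.Carrier S) p} →
    (∀ {x y} → Setoid._≈_ S x y → P x → P y) → Decidable P → Dec (∃ P)

  search-K : Searchable setoid
  search-K resp P? = map′
    (λ (i , p) → from i , p)
    (λ (x , p) → to x , resp (K.sym (strictlyInverseʳ x)) p)
    (Fin.any? (P? ∘ from))
    where open Inverse (FiniteField.enumeration F)

  search-Vector : ∀ {a ℓ} (S : Setoid a ℓ) → Searchable S →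
                  ∀ m → Searchable (VectorEquality.≋-setoid S m)
  search-Vector S s zero {P = P} resp P? = map′
    (_ ,_) (λ (x , p) → resp (λ ()) p) (P? (λ ()))
  search-Vector S s (suc m) {P = P} resp P? = map′
    (λ (a , v , p) → a Vector.∷ v , p)
    (λ (x , p) → x zero , (λ i → x (suc i)) , resp (≋-η x) p)
    (s (λ a≈b (v , p) → v , resp (∷-cong a≈b (λ _ → S.refl)) p)
       (λ a → search-Vector S s m
          (λ v≈w → resp (∷-cong (S.refl {a}) v≈w)) (λ v → P? (a Vector.∷ v))))
    where
    module S = Setoid S
    ∷-cong : ∀ {a b} {v w : Vector S.Carrier m} → a S.≈ b → (∀ i → v i S.≈ w i) →
             ∀ i → (a Vector.∷ v) i S.≈ (b Vector.∷ w) i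
    ∷-cong a≈b v≈w zero    = a≈b
    ∷-cong a≈b v≈w (suc i) = v≈w i
    ≋-η : ∀ x i → x i S.≈ (x zero Vector.∷ (λ j → x (suc j))) i
    ≋-η x zero    = S.refl
    ≋-η x (suc i) = S.refl

  search-Space : ∀ n → Searchable (≋-setoid n)
  search-Space = search-Vector setoid search-K

  Matrix : (k n : ℕ) → Setoid 0ℓ 0ℓ
  Matrix k n = VectorEquality.≋-setoid (≋-setoid n) k

  search-Matrix : ∀ k n → Searchable (Matrix k n)
  search-Matrix k n = search-Vector (≋-setoid n) (search-Space n) k

  _≈ᴹ_ : ∀ {n k} → Vector (Space n) k → Vector (Space n) k → Set
  b ≈ᴹ b′ = ∀ i → b i ≋ b′ i

  ≈ᴹ-sym : ∀ {n k} {b b′ : Vector (Space n) k} → b ≈ᴹ b′ → b′ ≈ᴹ b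
  ≈ᴹ-sym e i j = K.sym (e i j)

  _≟_ : Decidable₂ _≈_
  x ≟ y = map′
    (λ e → K.trans (K.sym (strictlyInverseʳ x))
             (K.trans (from-cong e) (strictlyInverseʳ y)))
    to-cong (to x Fin.≟ to y)
    where open Inverse (FiniteField.enumeration F)

  _≋?_ : ∀ {n} → Decidable₂ (_≋_ {n})
  x ≋? y = Fin.all? (λ i → x i ≟ y i)

  1≉0 : ¬ 1# ≈ 0#
  1≉0 1≈0 = #-irrefl (K.sym 1≈0) (invertible⇒# (1# , eqn , eqn))
    where
    open FiniteField F using (#-irrefl; invertible⇒#)
    0-1≈1 : 0# K.- 1# ≈ 1#
    0-1≈1 = K.trans (K.+-congˡ (K.-‿cong 1≈0)) (K.trans (K.-‿inverseʳ 0#) (K.sym 1≈0))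
    eqn : ∀ {y} → y ≈ 1#
    eqn {y} = K.trans (K.sym (K.*-identityʳ y))
      (K.trans (K.*-congˡ 1≈0) (K.trans (K.zeroʳ y) (K.sym 1≈0)))

  combination-cong : ∀ {n k} {c c′ : Vector Carrier k} {b b′ : Vector (Space n) k} →
    c ≋ c′ → b ≈ᴹ b′ → combination c b ≋ combination c′ b′
  combination-cong c≋c′ b≈b′ j = sum-cong-≋ (λ i → K.*-cong (c≋c′ i) (b≈b′ i j))

  combination-0 : ∀ {n k} (b : Vector (Space n) k) → combination 0ᵛ b ≋ 0ᵛ
  combination-0 {k = k} b j = K.trans (sum-cong-≋ (λ i → K.zeroˡ (b i j))) (sum-replicate-zero k)

  combination-+ : ∀ {n k} (c d : Vector Carrier k) (b : Vector (Space n) k) →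
    combination c b +ᵛ combination d b ≋ combination (c +ᵛ d) b
  combination-+ c d b j = K.trans (K.sym (∑-distrib-+ (λ i → c i *ᶠ b i j) (λ i → d i *ᶠ b i j)))
    (sum-cong-≋ (λ i → K.sym (K.distribʳ (b i j) (c i) (d i))))

  combination-* : ∀ {n k} a (c : Vector Carrier k) (b : Vector (Space n) k) →
    a *ᵛ combination c b ≋ combination (a *ᵛ c) b
  combination-* a c b j = K.trans (*-distribˡ-sum a (λ i → c i *ᶠ b i j))
    (sum-cong-≋ (λ i → K.sym (K.*-assoc a (c i) (b i j))))

  unit : ∀ {k} → Fin k → Vector Carrier k
  unit zero    zero    = 1#
  unit zero    (suc j) = 0#
  unit (suc i) zero    = 0#
  unit (suc i) (suc j) = unit i j

  combination-unit : ∀ {n k} i (b : Vector (Space n) k) → combination (unit i) b ≋ b i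
  combination-unit zero b j = K.trans
    (K.+-cong (K.*-identityˡ (b zero j)) (combination-0 (λ i → b (suc i)) j))
    (K.+-identityʳ (b zero j))
  combination-unit (suc i) b j = K.trans
    (K.+-cong (K.zeroˡ (b zero j)) (combination-unit i (λ i → b (suc i)) j))
    (K.+-identityˡ (b (suc i) j))

  InSpan : ∀ {n k} → Vector (Space n) k → Pred (Space n) 0ℓ
  InSpan b x = ∃[ c ] combination c b ≋ x

  InSpan? : ∀ {n k} (b : Vector (Space n) k) → Decidable (InSpan b)
  InSpan? {k = k} b x = search-Space k
    (λ c≋c′ e → ≋-trans (combination-cong (λ i → K.sym (c≋c′ i)) (λ _ _ → K.refl)) e)
    (λ c → combination c b ≋? x)

  InSpan-resp : ∀ {n k} {b b′ : Vector (Space n) k} {x y} →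
    b ≈ᴹ b′ → x ≋ y → InSpan b x → InSpan b′ y
  InSpan-resp b≈b′ x≋y (c , e) =
    c , ≋-trans (combination-cong (λ _ → K.refl) (≈ᴹ-sym b≈b′)) (≋-trans e x≋y)

  independent-resp : ∀ {n k} {b b′ : Vector (Space n) k} →
    b ≈ᴹ b′ → LinearlyIndependent b → LinearlyIndependent b′
  independent-resp b≈b′ ind c e =
    ind c (≋-trans (combination-cong (λ _ → K.refl) b≈b′) e)

  independent? : ∀ {n k} → Decidable (LinearlyIndependent {n} {k})
  independent? {k = k} b = map′
    (λ ∄c c e → decidable-stable (c ≋? 0ᵛ) (λ c≢0 → ∄c (c , e , c≢0)))
    (λ ind (c , e , c≢0) → c≢0 (ind c e))
    (¬? (search-Space k
      (λ c≋c′ (e , c≢0) →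
          ≋-trans (combination-cong (λ i → K.sym (c≋c′ i)) (λ _ _ → K.refl)) e
        , λ c′≋0 → c≢0 (≋-trans c≋c′ c′≋0))
      (λ c → (combination c b ≋? 0ᵛ) ×-dec ¬? (c ≋? 0ᵛ))))

  span : ∀ {n k} (b : Vector (Space n) k) → LinearlyIndependent b → Subspace n k
  span b ind = record
    { linearSubspace = record
      { Member   = InSpan b
      ; respects = InSpan-resp (λ _ _ → K.refl)
      ; 0-closed = 0ᵛ , combination-0 b
      ; +-closed = λ (c , e) (d , f) →
          c +ᵛ d , ≋-trans (≋-sym (combination-+ c d b)) (λ j → K.+-cong (e j) (f j))
      ; *-closed = λ a (c , e) →
          a *ᵛ c , ≋-trans (≋-sym (combination-* a c b)) (λ j → K.*-congˡ (e j))
      }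
    ; basis       = b
    ; basis-∈     = λ i → unit i , combination-unit i b
    ; independent = ind
    ; spanning    = λ m → m
    }

  module _ {n k : ℕ} (S : Subspace n k) where
    open Subspace S using (basis; basis-∈; independent; spanning; respects; 0-closed; +-closed; *-closed)

    combination-∈ : ∀ {l} c (b : Vector (Space n) l) → (∀ i → b i ∈ Member S) →
                    combination c b ∈ Member S
    combination-∈ {zero}  c b b∈S = 0-closed
    combination-∈ {suc l} c b b∈S = +-closed (*-closed (c zero) (b∈S zero))
      (combination-∈ (λ i → c (suc i)) (λ i → b (suc i)) (λ i → b∈S (suc i)))

    InSpan-basis⇒∈ : ∀ {x} → InSpan basis x → x ∈ Member S
    InSpan-basis⇒∈ (c , e) = respects e (combination-∈ c basis basis-∈)

  Meets : ∀ {n k l} → Vector (Space n) k → Vector (Space n) l → Set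
  Meets b b′ = ∃[ x ] InSpan b x × InSpan b′ x × ¬ x ≋ 0ᵛ

  Meets? : ∀ {n k l} (b : Vector (Space n) k) (b′ : Vector (Space n) l) → Dec (Meets b b′)
  Meets? {n} b b′ = search-Space n
    (λ x≋y (p , p′ , x≢0) →
        InSpan-resp (λ _ _ → K.refl) x≋y p
      , InSpan-resp (λ _ _ → K.refl) x≋y p′
      , λ y≋0 → x≢0 (≋-trans x≋y y≋0))
    (λ x → InSpan? b x ×-dec InSpan? b′ x ×-dec ¬? (x ≋? 0ᵛ))

  Meets-resp : ∀ {n k l} {b c : Vector (Space n) k} {b′ c′ : Vector (Space n) l} →
    b ≈ᴹ c → b′ ≈ᴹ c′ → Meets b b′ → Meets c c′
  Meets-resp b≈c b′≈c′ (x , p , p′ , x≢0) =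
    x , InSpan-resp b≈c ≋-refl p , InSpan-resp b′≈c′ ≋-refl p′ , x≢0

  meets-bases : ∀ {n k l} {S : Subspace n k} {T : Subspace n l} →
    MeetsNontrivially S T → Meets (Subspace.basis S) (Subspace.basis T)
  meets-bases {S = S} {T} (x , p , p′ , x≢0) =
    x , Subspace.spanning S p , Subspace.spanning T p′ , x≢0

  bases-meet : ∀ {n k l} {S : Subspace n k} {T : Subspace n l} →
    Meets (Subspace.basis S) (Subspace.basis T) → MeetsNontrivially S T
  bases-meet {S = S} {T} (x , p , p′ , x≢0) =
    x , InSpan-basis⇒∈ S p , InSpan-basis⇒∈ T p′ , x≢0

  AtMost-map : ∀ {p r N L} {P : Pred (Fin N) p} {R : Pred (Fin N) r} →
    (∀ {i} → R i → P i) → AtMost L P → AtMost L R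
  AtMost-map f h X X⊆R = h X (λ i∈X → f (X⊆R i∈X))

  AtMost? : ∀ {p N} L {P : Pred (Fin N) p} → Decidable P → Dec (AtMost L P)
  AtMost? L P? = map′
    (λ ∄X X X⊆P → ℕ.≮⇒≥ (λ L< → ∄X (X , (λ i i∈X → X⊆P i∈X) , L<)))
    (λ h (X , X⊆P , L<) → ℕ.<⇒≱ L< (h X (λ {i} → X⊆P i)))
    (¬? (Subset.anySubset? (λ X →
      Fin.all? (λ i → (i Subset.∈? X) →-dec P? i) ×-dec (L ℕ.<? ∣ X ∣))))

  IsASBases : ∀ {n k N} → ℕ → Vector (Vector (Space n) k) N → Set
  IsASBases {n} {k} L B =
      (∀ i → LinearlyIndependent (B i))
    × (∀ i j → i ≢ j → ¬ Meets (B i) (B j))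
    × ¬ (∃[ U ] LinearlyIndependent {n} {suc k} U × ¬ AtMost L (λ j → Meets U (B j)))

  IsASBases? : ∀ {n k N} L → Decidable (IsASBases {n} {k} {N} L)
  IsASBases? {n} {k} L B =
    Fin.all? (λ i → independent? (B i))
    ×-dec Fin.all? (λ i → Fin.all? (λ j → ¬? (i Fin.≟ j) →-dec ¬? (Meets? (B i) (B j))))
    ×-dec ¬? (search-Matrix (suc k) n
      (λ U≈U′ (ind , h) → independent-resp U≈U′ ind
        , λ h′ → h (AtMost-map (Meets-resp U≈U′ (λ _ _ → K.refl)) h′))
      (λ U → independent? U ×-dec ¬? (AtMost? L (λ j → Meets? U (B j)))))

  IsASBases-resp : ∀ {n k N} L {B B′ : Vector (Vector (Space n) k) N} →
    (∀ i → B i ≈ᴹ B′ i) → IsASBases L B → IsASBases L B′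
  IsASBases-resp L B≈B′ (ind , spread , sparse) =
      (λ i → independent-resp (B≈B′ i) (ind i))
    , (λ i j i≢j m → spread i j i≢j (Meets-resp (≈ᴹ-sym (B≈B′ i)) (≈ᴹ-sym (B≈B′ j)) m))
    , (λ (U , indU , h) → sparse (U , indU , λ h′ →
        h (AtMost-map (λ {i} → Meets-resp {b = U} (λ _ _ → K.refl) (≈ᴹ-sym (B≈B′ i))) h′)))

  IsASBases⇒IsAS : ∀ {n k N} L (B : Vector (Vector (Space n) k) N) →
    IsASBases L B → IsASCardinality n k L N
  IsASBases⇒IsAS {n} {k} {N} L B (ind , spread , sparse) = 𝓕 ,
      (λ i j i≢j x p p′ → decidable-stable (x ≋? 0ᵛ)
        (λ x≢0 → spread i j i≢j (x , p , p′ , x≢0)))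
    , (λ U → AtMost-map (λ {j} → meets-bases {S = U} {𝓕 j})
        (decidable-stable (AtMost? L (λ j → Meets? (Subspace.basis U) (B j)))
          (λ h → sparse (Subspace.basis U , Subspace.independent U , h))))
    where
    𝓕 : Family n k N
    𝓕 i = span (B i) (ind i)

  IsAS⇒IsASBases : ∀ {n k N} L → IsASCardinality n k L N → ∃ (IsASBases {n} {k} {N} L)
  IsAS⇒IsASBases L (𝓕 , spread , sparse) = (λ i → Subspace.basis (𝓕 i)) ,
      (λ i → Subspace.independent (𝓕 i))
    , (λ i j i≢j m → let (x , p , p′ , x≢0) = bases-meet {S = 𝓕 i} {𝓕 j} m
                     in x≢0 (spread i j i≢j x p p′))
    , (λ (U , ind , h) → h (AtMost-map
        (λ {j} → bases-meet {S = span U ind} {𝓕 j}) (sparse (span U ind))))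

  IsASCardinality? : ∀ n k L → Decidable (IsASCardinality n k L)
  IsASCardinality? n k L N = map′
    (λ (B , h) → IsASBases⇒IsAS L B h)
    (IsAS⇒IsASBases L)
    (search-Vector (Matrix k n) (search-Matrix k n) N (IsASBases-resp L) (IsASBases? L))

  IsASCardinality-0 : ∀ n k L → IsASCardinality n k L 0
  IsASCardinality-0 n k L = (λ ()) , (λ ()) , λ { U Vec.[] _ → z≤n }

  IsASCardinality-bounded : ∀ n k .{{_ : NonZero k}} L {N} →
                            IsASCardinality n k L N → N ≤ q ^ n
  IsASCardinality-bounded n (suc k) L {N} (𝓕 , spread , _) = Fin.injective⇒≤ code-injective
    where
    open Inverse (FiniteField.enumeration F)
    v : Fin N → Space n
    v i = Subspace.basis (𝓕 i) zero

    v≢0 : ∀ i → ¬ v i ≋ 0ᵛ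
    v≢0 i v≋0 = 1≉0 (Subspace.independent (𝓕 i) (unit zero)
      (≋-trans (combination-unit zero (Subspace.basis (𝓕 i))) v≋0) zero)

    code : Fin N → Fin (q ^ n)
    code i = funToFin (to ∘ v i)

    code-≋ : ∀ {i j} → code i ≡ code j → v i ≋ v j
    code-≋ {i} {j} e m = K.trans (K.sym (strictlyInverseʳ (v i m)))
      (K.trans (from-cong to≡to) (strictlyInverseʳ (v j m)))
      where
      to≡to : to (v i m) ≡ to (v j m)
      to≡to = ≡.trans (≡.sym (Fin.finToFun-funToFin (to ∘ v i) m))
        (≡.trans (cong (λ c → finToFun c m) e) (Fin.finToFun-funToFin (to ∘ v j) m))

    code-injective : ∀ {i j} → code i ≡ code j → i ≡ j
    code-injective {i} {j} e = decidable-stable (i Fin.≟ j) (λ i≢j →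
      v≢0 j (spread i j i≢j (v j)
        (Subspace.respects (𝓕 i) (code-≋ e) (Subspace.basis-∈ (𝓕 i) zero))
        (Subspace.basis-∈ (𝓕 j) zero)))

  maximum : ∀ {p} {P : Pred ℕ p} → Decidable P → P 0 →
            ∀ B → (∀ {N} → P N → N ≤ B) → ∃ (IsMaximum P)
  maximum P? p₀ zero    bounded = 0 , p₀ , λ _ → bounded
  maximum P? p₀ (suc B) bounded with P? (suc B)
  ... | yes p = suc B , p , λ _ → bounded
  ... | no ¬p = maximum P? p₀ B
    (λ p → ℕ.s≤s⁻¹ (ℕ.≤∧≢⇒< (bounded p) (λ { refl → ¬p p })))

  abstract
    maxAS : ∀ n k .{{_ : NonZero k}} L → ∃ (IsMaximum (IsASCardinality n k L))
    maxAS n k L = maximum (IsASCardinality? n k L) (IsASCardinality-0 n k L)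
      (q ^ n) (IsASCardinality-bounded n k L)

mAS : ∀ {q} → FiniteField q → (n k : ℕ) .{{_ : NonZero k}} (L : ℕ) → ℕ
mAS F n k L = proj₁ (Families.maxAS F n k L)

-- Extended upper reals: a number in [-∞, +∞] is given by the set of
-- rationals strictly above it.  Infima and suprema, hence upper limits,
-- always exist.

record UpperReal : Set₂ where
  field
    Above   : ℚ → Set₁
    upwards : ∀ {r s} → r <ℚ s → Above r → Above s
    rounded : ∀ {s} → Above s → ∃[ r ] r <ℚ s × Above r

open UpperReal public

infix 4 _≤ᵘ_

_≤ᵘ_ : UpperReal → UpperReal → Set₁
x ≤ᵘ y = ∀ {r} → Above y r → Above x r

private
  above : (ℚ → Set₁) → UpperReal
  above P = record
    { Above   = λ s → ∃[ r ] r <ℚ s × P r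
    ; upwards = λ s<t (r , r<s , p) → r , ℚ.<-trans r<s s<t , p
    ; rounded = λ (r , r<s , p) → let (t , r<t , t<s) = ℚ.<-dense r<s in t , t<s , r , r<t , p
    }

fromℚ : ℚ → UpperReal
fromℚ x = record
  { Above   = λ r → Lift _ (x <ℚ r)
  ; upwards = λ r<s (lift x<r) → lift (ℚ.<-trans x<r r<s)
  ; rounded = λ (lift x<s) → let (r , x<r , r<s) = ℚ.<-dense x<s in r , r<s , lift x<r
  }

⨆ : {I : Set₁} → (I → UpperReal) → UpperReal
⨆ x = above (λ r → ∀ i → Above (x i) r)

⨅ : {I : Set} → (I → UpperReal) → UpperReal
⨅ x = record
  { Above   = λ r → ∃[ i ] Above (x i) r
  ; upwards = λ r<s (i , p) → i , upwards (x i) r<s p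
  ; rounded = λ (i , p) → let (r , r<s , p′) = rounded (x i) p in r , r<s , i , p′
  }

-- m ≤ q^s for a rational exponent s = a / b, with denominators and
-- negative powers cleared: m ^ b ≤ q ^ a.
_≤_^ℚ_ : ℕ → ℕ → ℚ → Set
m ≤ q ^ℚ mkℚ (+ a)    b-1 _ = m ^ suc b-1 ≤ q ^ a
m ≤ q ^ℚ mkℚ -[1+ a ] b-1 _ = m ^ suc b-1 ℕ.* q ^ suc a ≤ 1

-- The base-q logarithm of m, for q ≥ 2.
log : (q m : ℕ) → UpperReal
log q m = above (λ s → Lift _ (m ≤ q ^ℚ s))

-- Finite fields of a given order exist and are unique up to isomorphism
-- exactly for prime powers, so an upper limit over prime powers q is an
-- upper limit over all finite fields as their order q grows.
record FieldBeyond (Q : ℕ) : Set₁ where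
  field
    {order}     : ℕ
    primePower  : IsPrimePower order
    large       : Q ≤ order
    finiteField : FiniteField order

limsup : (∀ {q} → FiniteField q → UpperReal) → UpperReal
limsup x = ⨅ λ Q → ⨆ {FieldBeyond Q} λ 𝔽 → x (FieldBeyond.finiteField 𝔽)

pAS : (n k : ℕ) .{{_ : NonZero k}} (L : ℕ → ℕ) → UpperReal
pAS n k L = limsup λ {q} F → log q (mAS F n k (L q))

-- L(q) = q^o(1) along prime powers: log_q L(q) → 0.
IsSubpolynomial : (ℕ → ℕ) → Set₁
IsSubpolynomial L = ∀ ε → 0ℚ <ℚ ε → ∃[ Q ] (∀ q → IsPrimePower q → Q ≤ q →
  fromℚ (- ε) ≤ᵘ log q (L q) × Above (log q (L q)) ε)

{-# OPTIONS --safe #-}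
-- Fix S in the family.  Every other member T meets S trivially, so the sums
-- t + s with 0 ≠ t ∈ T and s ∈ S are (q^k - 1) q^k distinct vectors outside S, and
-- v arises in this way from T only if v + S meets T.  Counting the pairs (T , v)
-- avoids the quotient by S: (N - 1) (q^k - 1) q^k ≤ L (q^n - q^k).
--
-- If u ∉ S and u + S meets T, then T meets the (k+1)-dimensional space ⟨u⟩ + S
-- nontrivially, so AS families are AAD.  The bound then gives N ≤ 4 L q^(n-2k).
module Submission where

open import Defs
import Algebra.Properties.AbelianGroup as AbelianGroupProperties
import Algebra.Properties.Ring as RingProperties
import Algebra.Properties.Semiring.Sum as SemiringSum
open import Data.Bool.Base using (true; false)
open import Data.Fin.Base using (Fin; zero; suc; funToFin; finToFun; remQuot; combine; punchIn)
import Data.Fin.Properties as Fin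
open import Data.Fin.Subset using (∣_∣) renaming (_∈_ to _∈ˢ_)
import Data.Fin.Subset.Properties as Subset
open import Data.Integer.Base as ℤ using (+_; -[1+_])
import Data.Integer.Properties as ℤ
open import Data.Nat.Base
  using (ℕ; zero; suc; _+_; _*_; _^_; _∸_; _⊔_; _≤_; _<_; z≤n; s≤s; NonZero; >-nonZero; >-nonZero⁻¹; ≢-nonZero⁻¹)
import Data.Nat.Properties as ℕ
open import Data.Product.Base using (∃-syntax; _×_; _,_; proj₁; proj₂)
open import Data.Rational.Base using (mkℚ; 1ℚ; _/_; toℚᵘ)
  renaming (_+_ to _+ℚ_; _*_ to _*ℚ_; _≤_ to _≤ℚ_; _<_ to _<ℚ_)
import Data.Rational.Properties as ℚ
open import Data.Rational.Unnormalised.Base as ℚᵘ using (mkℚᵘ; 1ℚᵘ; *≤*)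
import Data.Rational.Unnormalised.Properties as ℚᵘ
open import Data.Sum.Base using (inj₁; inj₂)
import Data.Vec.Base as Vec
open import Data.Vec.Functional as Vector using (Vector)
open import Function.Base using (_∘_)
open import Function.Bundles using (Inverse)
open import Level using (Level; lift)
import Relation.Binary.Reasoning.Setoid as SetoidReasoning
open import Relation.Binary.PropositionalEquality
  using (_≡_; refl; cong; cong₂; sym; trans; subst; subst₂; module ≡-Reasoning)
open import Relation.Nullary using (¬_; Dec; yes; no; contradiction)
open import Relation.Nullary.Decidable using (map′; ¬?; _×-dec_)
open import Relation.Unary using (Pred; Decidable; _∈_; _∉_; _≬_)

open SemiringSum ℕ.+-*-semiring using (sum; sum-cong-≋; ∑-comm; ∑-distrib-+; *-distribˡ-sum)

-- Finite sums, counting and double counting.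

sum-mono : ∀ {n} {f g : Fin n → ℕ} → (∀ i → f i ≤ g i) → sum f ≤ sum g
sum-mono {zero}  f≤g = z≤n
sum-mono {suc n} f≤g = ℕ.+-mono-≤ (f≤g zero) (sum-mono (f≤g ∘ suc))

sum-const : ∀ n c → sum {n} (λ _ → c) ≡ n * c
sum-const zero    c = refl
sum-const (suc n) c = cong (_+_ c) (sum-const n c)

indicator : ∀ {p} {P : Set p} → Dec P → ℕ
indicator (yes _) = 1
indicator (no _)  = 0

indicator-¬ : ∀ {p} {P : Set p} (P? : Dec P) → indicator P? + indicator (¬? P?) ≡ 1
indicator-¬ (yes _) = refl
indicator-¬ (no _)  = refl

module _ {p : Level} where

  count : ∀ {n} {P : Pred (Fin n) p} → Decidable P → ℕ
  count P? = sum (λ i → indicator (P? i))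

  count-¬ : ∀ {n} {P : Pred (Fin n) p} (P? : Decidable P) →
            count P? + sum (λ i → indicator (¬? (P? i))) ≡ n
  count-¬ {n} P? = begin
    count P? + sum (λ i → indicator (¬? (P? i)))
      ≡⟨ sym (∑-distrib-+ (λ i → indicator (P? i)) (λ i → indicator (¬? (P? i)))) ⟩
    sum (λ i → indicator (P? i) + indicator (¬? (P? i)))
      ≡⟨ sum-cong-≋ (λ i → indicator-¬ (P? i)) ⟩
    sum {n} (λ _ → 1)
      ≡⟨ sum-const n 1 ⟩
    n * 1
      ≡⟨ ℕ.*-identityʳ n ⟩
    n ∎
    where open ≡-Reasoning

  -- `AtMost` quantifies over explicit subsets, so a count must be realised as the size of one
  -- before the hypothesis applies.
  satisfying : ∀ {n} {P : Pred (Fin n) p} (P? : Decidable P) →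
               ∃[ X ] (∀ {i} → i ∈ˢ X → P i) × count P? ≡ ∣ X ∣
  satisfying {zero}  P? = Vec.[] , (λ ()) , refl
  satisfying {suc n} P? with P? zero | satisfying (P? ∘ suc)
  ... | yes p₀ | X , X⊆P , eq = true Vec.∷ X ,
          (λ { Vec.here → p₀ ; (Vec.there i∈X) → X⊆P i∈X }) , cong suc eq
  ... | no _   | X , X⊆P , eq = false Vec.∷ X , (λ { (Vec.there i∈X) → X⊆P i∈X }) , eq

  AtMost⇒count≤ : ∀ {n L} {P : Pred (Fin n) p} (P? : Decidable P) → AtMost L P → count P? ≤ L
  AtMost⇒count≤ P? atMost with satisfying P?
  ... | X , X⊆P , eq = subst (_≤ _) (sym eq) (atMost X X⊆P)

  AtMost-none : ∀ {n} {P : Pred (Fin n) p} → (∀ i → ¬ P i) → AtMost 0 P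
  AtMost-none {n} ¬P X X⊆P = ℕ.≤-reflexive (trans
    (cong ∣_∣ (Subset.Empty-unique (λ (i , i∈X) → ¬P i (X⊆P i∈X)))) (Subset.∣⊥∣≡0 n))

  -- The number of indices before `i` that satisfy `P`. It embeds the satisfying indices into
  -- `Fin (count P?)`, where the pigeonhole principle for `Fin` is available.
  rank : ∀ {n} {P : Pred (Fin n) p} (P? : Decidable P) i → P i → Fin (count P?)
  rank P? zero p with P? zero
  ... | yes _ = zero
  ... | no ¬p = contradiction p ¬p
  rank P? (suc i) p with P? zero
  ... | yes _ = suc (rank (P? ∘ suc) i p)
  ... | no _  = rank (P? ∘ suc) i p

  rank-injective : ∀ {n} {P : Pred (Fin n) p} (P? : Decidable P) {i j} (p : P i) (p′ : P j) →
                   rank P? i p ≡ rank P? j p′ → i ≡ j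
  rank-injective P? {zero} {zero} p p′ eq = refl
  rank-injective P? {zero} {suc j} p p′ eq with P? zero
  rank-injective P? {zero} {suc j} p p′ () | yes _
  ... | no ¬p = contradiction p ¬p
  rank-injective P? {suc i} {zero} p p′ eq with P? zero
  rank-injective P? {suc i} {zero} p p′ () | yes _
  ... | no ¬p = contradiction p′ ¬p
  rank-injective P? {suc i} {suc j} p p′ eq with P? zero
  ... | yes _ = cong suc (rank-injective (P? ∘ suc) p p′ (Fin.suc-injective eq))
  ... | no _  = cong suc (rank-injective (P? ∘ suc) p p′ eq)

  injective⇒≤count : ∀ {m n} {P : Pred (Fin n) p} (P? : Decidable P) (f : Fin m → Fin n) →
                     (∀ {x y} → f x ≡ f y → x ≡ y) → (∀ x → P (f x)) → m ≤ count P?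
  injective⇒≤count P? f f-injective Pf =
    Fin.injective⇒≤ (λ {x} {y} eq → f-injective (rank-injective P? (Pf x) (Pf y) eq))

  -- The indicators of `R` are summed by rows and then by columns. The column bound `c` varies with
  -- `v` so that the vectors inside the fixed subspace can be given the bound 0.
  double-count : ∀ {m n r} {R : Fin m → Pred (Fin n) p} (R? : ∀ j → Decidable (R j)) (c : Fin n → ℕ) →
                 (∀ j → r ≤ count (R? j)) → (∀ v → count (λ j → R? j v) ≤ c v) → m * r ≤ sum c
  double-count {m} {n} {r} R? c rows columns = begin
    m * r                                              ≡⟨ sym (sum-const m r) ⟩
    sum {m} (λ _ → r)                                  ≤⟨ sum-mono rows ⟩
    sum (λ j → sum (λ v → indicator (R? j v)))         ≡⟨ ∑-comm (λ j v → indicator (R? j v)) ⟩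
    sum (λ v → sum (λ j → indicator (R? j v)))         ≤⟨ sum-mono columns ⟩
    sum c                                              ∎
    where open ℕ.≤-Reasoning

-- Codes of functions, and enumerations that skip one index.

funToFin-cong : ∀ {m n} {f g : Fin m → Fin n} → (∀ i → f i ≡ g i) → funToFin f ≡ funToFin g
funToFin-cong {zero}  f≗g = refl
funToFin-cong {suc m} f≗g = cong₂ combine (f≗g zero) (funToFin-cong (f≗g ∘ suc))

-- Typed with `m ∸ 1` so that it applies to `m = q ^ k`, which is not a successor by computation.
avoiding : ∀ {m} → Fin m → Fin (m ∸ 1) → Fin m
avoiding {suc m} = punchIn

avoiding-≢ : ∀ {m} (i : Fin m) x → ¬ avoiding i x ≡ i
avoiding-≢ {suc m} = Fin.punchInᵢ≢i

avoiding-injective : ∀ {m} (i : Fin m) {x y} → avoiding i x ≡ avoiding i y → x ≡ y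
avoiding-injective {suc m} i = Fin.punchIn-injective i _ _

-- Vectors over the field as elements of `Fin (q ^ n)`.

module _ {q : ℕ} (F : FiniteField q) where

  open Families F
  open RingProperties K.ring using (-1*x≈-x; x∙y⁻¹≈ε⇒x≈y; x≈y⇒x∙y⁻¹≈ε; -0#≈0#)
    renaming (//-rightDividesʳ to y+x-x≈y)
  open AbelianGroupProperties K.+-abelianGroup using (xyx⁻¹≈y)
  open Inverse (FiniteField.enumeration F) using (to; from; to-cong; from-cong; strictlyInverseʳ; strictlyInverseˡ)

  encode : ∀ {n} → Space n → Fin (q ^ n)
  encode x = funToFin (to ∘ x)

  decode : ∀ {n} → Fin (q ^ n) → Space n
  decode i = from ∘ finToFun i

  decode-encode : ∀ {n} (x : Space n) → decode (encode x) ≋ x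
  decode-encode x m = K.trans (from-cong (Fin.finToFun-funToFin (to ∘ x) m)) (strictlyInverseʳ (x m))

  encode-decode : ∀ {n} (i : Fin (q ^ n)) → encode {n} (decode i) ≡ i
  encode-decode {n} i = trans (funToFin-cong (λ m → strictlyInverseˡ (finToFun {n = n} i m)))
                              (Fin.funToFin-finToFin {n} i)

  encode-cong : ∀ {n} {x y : Space n} → x ≋ y → encode x ≡ encode y
  encode-cong x≋y = funToFin-cong (λ m → to-cong (x≋y m))

  encode-injective : ∀ {n} {x y : Space n} → encode x ≡ encode y → x ≋ y
  encode-injective {x = x} {y} eq = ≋-trans (≋-sym (decode-encode x))
    (≋-trans (λ m → K.reflexive (cong (λ i → decode i m) eq)) (decode-encode y))

  decode-injective : ∀ {n} {i j : Fin (q ^ n)} → decode {n} i ≋ decode j → i ≡ j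
  decode-injective {n} {i} {j} eq =
    trans (sym (encode-decode {n} i)) (trans (encode-cong eq) (encode-decode {n} j))

  infixl 6 _-ᵛ_

  _-ᵛ_ : ∀ {n} → Space n → Space n → Space n
  (x -ᵛ y) i = x i K.- y i

  -ᵛ-scaled : ∀ {n} (x y : Space n) → x +ᵛ (K.- 1#) *ᵛ y ≋ x -ᵛ y
  -ᵛ-scaled x y i = K.+-congˡ (-1*x≈-x (y i))

  -- The combination with coefficients `c - d` vanishes. The difference is written `c + (-1) d` so
  -- that additivity and homogeneity of `combination` apply to it.
  combination-injective : ∀ {n k} {b : Vector (Space n) k} → LinearlyIndependent b →
                          ∀ {c d} → combination c b ≋ combination d b → c ≋ d
  combination-injective {b = b} ind {c} {d} eq i = x∙y⁻¹≈ε⇒x≈y (c i) (d i)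
    (K.trans (K.sym (-ᵛ-scaled c d i)) (ind (c +ᵛ (K.- 1#) *ᵛ d) difference≋0 i))
    where
    difference≋0 : combination (c +ᵛ (K.- 1#) *ᵛ d) b ≋ 0ᵛ
    difference≋0 j = K.trans (K.sym (combination-+ c ((K.- 1#) *ᵛ d) b j))
      (K.trans (K.+-congˡ (K.sym (combination-* (K.- 1#) d b j)))
      (K.trans (-ᵛ-scaled (combination c b) (combination d b) j)
               (x≈y⇒x∙y⁻¹≈ε (eq j))))

  -- Membership, translates and enumerated points of a subspace.

  module _ {n k : ℕ} (S : Subspace n k) where
    open Subspace S

    -ᵛ-closed : ∀ {x y} → x ∈ Member → y ∈ Member → x -ᵛ y ∈ Member
    -ᵛ-closed {x} {y} x∈S y∈S = respects (-ᵛ-scaled x y) (+-closed x∈S (*-closed (K.- 1#) y∈S))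

    Member? : Decidable Member
    Member? x = map′ (InSpan-basis⇒∈ S) spanning (InSpan? basis x)

    Translate-resp : ∀ {u u′ x x′} → u ≋ u′ → x ≋ x′ → Translate u S x → Translate u′ S x′
    Translate-resp u≋u′ x≋x′ (v , v∈S , eq) =
      v , v∈S , λ i → K.trans (K.sym (x≋x′ i)) (K.trans (eq i) (K.+-congʳ (u≋u′ i)))

    Translate? : ∀ u → Decidable (Translate u S)
    Translate? u x = search-Space n
      (λ v≋w (v∈S , eq) → respects v≋w v∈S , λ i → K.trans (eq i) (K.+-congˡ (v≋w i)))
      (λ v → Member? v ×-dec (x ≋? (u +ᵛ v)))

    -- The code `a` is read as a coordinate vector with respect to the basis; independence makes the
    -- q^k points distinct.
    point : Fin (q ^ k) → Space n
    point a = combination (decode a) basis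

    point-∈ : ∀ a → point a ∈ Member
    point-∈ a = combination-∈ S (decode a) basis basis-∈

    point-injective : ∀ {a b} → point a ≋ point b → a ≡ b
    point-injective eq = decode-injective {k} (combination-injective independent eq)

    origin : Fin (q ^ k)
    origin = encode {k} 0ᵛ

    point-origin : point origin ≋ 0ᵛ
    point-origin = ≋-trans (combination-cong (decode-encode {k} 0ᵛ) (λ _ _ → K.refl)) (combination-0 basis)

    nonzeroPoint : Fin (q ^ k ∸ 1) → Space n
    nonzeroPoint a = point (avoiding origin a)

    nonzeroPoint-∈ : ∀ a → nonzeroPoint a ∈ Member
    nonzeroPoint-∈ a = point-∈ (avoiding origin a)

    nonzeroPoint-≢0 : ∀ a → ¬ nonzeroPoint a ≋ 0ᵛ
    nonzeroPoint-≢0 a eq = avoiding-≢ origin a (point-injective (≋-trans eq (≋-sym point-origin)))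

    q^k≤count∈ : q ^ k ≤ count (Member? ∘ decode {n})
    q^k≤count∈ = injective⇒≤count (Member? ∘ decode {n}) (encode ∘ point)
      (λ eq → point-injective (encode-injective eq))
      (λ a → respects (≋-sym (decode-encode (point a))) (point-∈ a))

    count∉≤ : count (λ v → ¬? (Member? (decode {n} v))) ≤ q ^ n ∸ q ^ k
    count∉≤ = begin
      ∉#                     ≡⟨ sym (ℕ.m+n∸m≡n ∈# ∉#) ⟩
      ∈# + ∉# ∸ ∈#           ≡⟨ cong (_∸ ∈#) (count-¬ (Member? ∘ decode {n})) ⟩
      q ^ n ∸ ∈#             ≤⟨ ℕ.∸-monoʳ-≤ (q ^ n) q^k≤count∈ ⟩
      q ^ n ∸ q ^ k          ∎
      where
      open ℕ.≤-Reasoning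
      ∈# = count (Member? ∘ decode {n})
      ∉# = count (λ v → ¬? (Member? (decode {n} v)))

  Translate-meets? : ∀ {n k l} u (S : Subspace n k) (T : Subspace n l) →
                     Dec (Translate u S ≬ Subspace.Member T)
  Translate-meets? {n} u S T = search-Space n
    (λ x≋y (x∈u+S , x∈T) → Translate-resp S ≋-refl x≋y x∈u+S , Subspace.respects T x≋y x∈T)
    (λ x → Translate? S u x ×-dec Member? T x)

  -- Sums of two subspaces that meet trivially.

  module _ {n k l : ℕ} (S : Subspace n k) (T : Subspace n l) (S∩T : TrivialIntersection S T) where
    private
      module S = Subspace S
      module T = Subspace T

    -- The vector t - t′ = s′ - s lies in both subspaces, hence is zero.
    +ᵛ-unique : ∀ {s s′ t t′} → s ∈ S.Member → s′ ∈ S.Member → t ∈ T.Member → t′ ∈ T.Member →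
                t +ᵛ s ≋ t′ +ᵛ s′ → t ≋ t′ × s ≋ s′
    +ᵛ-unique {s} {s′} {t} {t′} s∈S s′∈S t∈T t′∈T eq = t≋t′ , s≋s′
      where
      t-t′≋s′-s : t -ᵛ t′ ≋ s′ -ᵛ s
      t-t′≋s′-s i = begin
        t i K.- t′ i                              ≈⟨ K.+-congʳ (K.sym (y+x-x≈y (s i) (t i))) ⟩
        (t i K.+ s i K.- s i) K.- t′ i            ≈⟨ K.+-congʳ (K.+-congʳ (eq i)) ⟩
        (t′ i K.+ s′ i K.- s i) K.- t′ i          ≈⟨ K.+-congʳ (K.+-assoc (t′ i) (s′ i) (K.- s i)) ⟩
        (t′ i K.+ (s′ i K.- s i)) K.- t′ i        ≈⟨ xyx⁻¹≈y (t′ i) (s′ i K.- s i) ⟩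
        s′ i K.- s i                              ∎
        where open SetoidReasoning setoid

      t≋t′ : t ≋ t′
      t≋t′ i = x∙y⁻¹≈ε⇒x≈y (t i) (t′ i)
        (S∩T (t -ᵛ t′) (S.respects (≋-sym t-t′≋s′-s) (-ᵛ-closed S s′∈S s∈S)) (-ᵛ-closed T t∈T t′∈T) i)

      s≋s′ : s ≋ s′
      s≋s′ i = K.sym (x∙y⁻¹≈ε⇒x≈y (s′ i) (s i)
        (K.trans (K.sym (t-t′≋s′-s i)) (x≈y⇒x∙y⁻¹≈ε (t≋t′ i))))

    -- The first condition excludes the vectors of `S`: for them the translate is `S` itself, which
    -- always meets `T` in 0, and the AAD condition bounds only translates by vectors outside `S`.
    Hit : Fin (q ^ n) → Set
    Hit v = decode v ∉ S.Member × Translate (decode v) S ≬ T.Member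

    Hit? : Decidable Hit
    Hit? v = ¬? (Member? S (decode v)) ×-dec Translate-meets? (decode v) S T

    hit : Fin (q ^ l ∸ 1) → Fin (q ^ k) → Fin (q ^ n)
    hit a b = encode (nonzeroPoint T a +ᵛ point S b)

    hit-injective : ∀ {a b a′ b′} → hit a b ≡ hit a′ b′ → (a , b) ≡ (a′ , b′)
    hit-injective {a} {b} {a′} {b′} eq
      with +ᵛ-unique (point-∈ S b) (point-∈ S b′) (nonzeroPoint-∈ T a) (nonzeroPoint-∈ T a′)
             (encode-injective eq)
    ... | t≋t′ , s≋s′ =
      cong₂ _,_ (avoiding-injective (origin T) (point-injective T t≋t′)) (point-injective S s≋s′)

    -- The translate of `S` by t + s contains t = (t + s) + (0 - s). If t + s were in `S`, then t
    -- would be a nonzero common vector of `S` and `T`.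
    hit-Hit : ∀ a b → Hit (hit a b)
    hit-Hit a b = outside , t , (0ᵛ -ᵛ s , -ᵛ-closed S S.0-closed (point-∈ S b) , t≋) , nonzeroPoint-∈ T a
      where
      t = nonzeroPoint T a
      s = point S b

      t≋t+s-s : t ≋ (t +ᵛ s) -ᵛ s
      t≋t+s-s i = K.sym (y+x-x≈y (s i) (t i))

      t≋ : t ≋ decode (hit a b) +ᵛ (0ᵛ -ᵛ s)
      t≋ i = K.trans (t≋t+s-s i)
        (K.+-cong (K.sym (decode-encode (t +ᵛ s) i)) (K.sym (K.+-identityˡ (K.- s i))))

      outside : decode (hit a b) ∉ S.Member
      outside t+s∈S = nonzeroPoint-≢0 T a (S∩T t
        (S.respects (≋-sym t≋t+s-s) (-ᵛ-closed S (S.respects (decode-encode (t +ᵛ s)) t+s∈S) (point-∈ S b)))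
        (nonzeroPoint-∈ T a))

    count-Hit : (q ^ l ∸ 1) * q ^ k ≤ count Hit?
    count-Hit = injective⇒≤count Hit?
      (λ x → let a , b = remQuot {q ^ l ∸ 1} (q ^ k) x in hit a b)
      (λ {x} {y} eq → trans (sym (Fin.combine-remQuot {q ^ l ∸ 1} (q ^ k) x))
        (trans (cong (λ (a , b) → combine {q ^ l ∸ 1} {q ^ k} a b) (hit-injective eq))
               (Fin.combine-remQuot {q ^ l ∸ 1} (q ^ k) y)))
      (λ x → let a , b = remQuot {q ^ l ∸ 1} (q ^ k) x in hit-Hit a b)

  -- Counting pairs of a family member and a vector outside the fixed one.

  AAD-count : ∀ {n k L N} (𝓕 : Family n k (suc N)) → IsAAD L 𝓕 →
              N * ((q ^ k ∸ 1) * q ^ k) ≤ L * (q ^ n ∸ q ^ k)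
  AAD-count {n} {k} {L} {N} 𝓕 (spread , atMost) = begin
    N * ((q ^ k ∸ 1) * q ^ k)                                ≤⟨ double-count R? c rows columns ⟩
    sum c                                                    ≡⟨ sym (*-distribˡ-sum L (λ v → indicator (∉S? v))) ⟩
    L * count ∉S?                                            ≤⟨ ℕ.*-monoʳ-≤ L (count∉≤ S) ⟩
    L * (q ^ n ∸ q ^ k)                                      ∎
    where
    open ℕ.≤-Reasoning
    S = 𝓕 zero

    ∉S? : Decidable (λ v → decode {n} v ∉ Subspace.Member S)
    ∉S? v = ¬? (Member? S (decode v))

    c : Fin (q ^ n) → ℕ
    c v = L * indicator (∉S? v)

    trivial : ∀ j → TrivialIntersection S (𝓕 (suc j))
    trivial j = spread zero (suc j) (λ ())

    R? : ∀ j → Decidable (Hit S (𝓕 (suc j)) (trivial j))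
    R? j = Hit? S (𝓕 (suc j)) (trivial j)

    rows : ∀ j → (q ^ k ∸ 1) * q ^ k ≤ count (R? j)
    rows j = count-Hit S (𝓕 (suc j)) (trivial j)

    columns : ∀ v → count (λ j → R? j v) ≤ c v
    columns v = AtMost⇒count≤ (λ j → R? j v) (bound (∉S? v))
      where
      -- The decision is an argument, so that `indicator d` computes once it is matched.
      bound : (d : Dec (decode v ∉ Subspace.Member S)) →
              AtMost (L * indicator d) (λ j → Hit S (𝓕 (suc j)) (trivial j) v)
      -- `X` indexes the members other than `S`; prepending `false` turns it into a subset of the
      -- whole family of the same size.
      bound (yes v∉S) X X⊆R = subst (∣ X ∣ ≤_) (sym (ℕ.*-identityʳ L))
        (atMost zero (decode v) v∉S (false Vec.∷ X) (λ { (Vec.there j∈X) → proj₂ (X⊆R j∈X) }))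
      -- Here `v∈S` is only the negation of non-membership, which already refutes the first
      -- component of every `Hit`.
      bound (no v∈S) = subst (λ m → AtMost m (λ j → Hit S (𝓕 (suc j)) (trivial j) v))
        (sym (ℕ.*-zeroʳ L)) (AtMost-none (λ j (v∉S , _) → v∈S v∉S))

  -- AS families are AAD.

  module _ {n k : ℕ} (S : Subspace n k) {u : Space n} (u∉S : u ∉ Subspace.Member S) where
    open Subspace S
    open FiniteField F using (_#_; tight; #⇒invertible)

    -- If the coefficient of `u` were apart from zero, dividing by it would express `u` through the
    -- basis of `S`. Tightness therefore makes it zero, and independence of the basis settles the
    -- rest.
    ∷-independent : LinearlyIndependent (u Vector.∷ basis)
    ∷-independent c eq = λ { zero → c₀≈0 ; (suc i) → independent tail tail≋0 i }
      where
      tail = λ i → c (suc i)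

      -- Apartness of `c zero` and 0 yields an inverse of their difference, hence the term
      -- `c zero K.- 0#`.
      invertible⇒u∈S : ∀ y → y K.* (c zero K.- 0#) ≈ 1# → u ∈ Member
      invertible⇒u∈S y y*c₀≈1 = respects y*[0-tail]≋u
        (*-closed y (-ᵛ-closed S 0-closed (combination-∈ S tail basis basis-∈)))
        where
        y*[0-tail]≋u : y *ᵛ (0ᵛ -ᵛ combination tail basis) ≋ u
        y*[0-tail]≋u j = begin
          y K.* (0# K.- t)                    ≈⟨ K.*-congˡ (K.+-congʳ (K.sym (eq j))) ⟩
          y K.* (c zero K.* u j K.+ t K.- t)  ≈⟨ K.*-congˡ (y+x-x≈y t (c zero K.* u j)) ⟩
          y K.* (c zero K.* u j)              ≈⟨ K.sym (K.*-assoc y (c zero) (u j)) ⟩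
          y K.* c zero K.* u j                ≈⟨ K.*-congʳ (K.*-congˡ (K.sym x-0≈x)) ⟩
          y K.* (c zero K.- 0#) K.* u j       ≈⟨ K.*-congʳ y*c₀≈1 ⟩
          1# K.* u j                          ≈⟨ K.*-identityˡ (u j) ⟩
          u j                                 ∎
          where
          open SetoidReasoning setoid
          t = combination tail basis j
          x-0≈x : c zero K.- 0# ≈ c zero
          x-0≈x = K.trans (K.+-congˡ -0#≈0#) (K.+-identityʳ (c zero))

      c₀≈0 : c zero ≈ 0#
      c₀≈0 = proj₁ (tight (c zero) 0#) λ c₀#0 →
        let y , y*c₀≈1 , _ = #⇒invertible c₀#0 in u∉S (invertible⇒u∈S y y*c₀≈1)

      tail≋0 : combination tail basis ≋ 0ᵛ
      tail≋0 j = K.trans (K.sym (K.+-identityˡ (combination tail basis j)))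
        (K.trans (K.+-congʳ (K.sym (K.trans (K.*-congʳ c₀≈0) (K.zeroˡ (u j))))) (eq j))

    adjoin : Subspace n (suc k)
    adjoin = span (u Vector.∷ basis) ∷-independent

    -- A common point x = u + v lies in the span of `u` and `S`; it is nonzero, since otherwise u =
    -- -v would be in `S`.
    Translate-meets⇒adjoin-meets : ∀ {l} (T : Subspace n l) →
      Translate u S ≬ Subspace.Member T → MeetsNontrivially adjoin T
    Translate-meets⇒adjoin-meets T (x , (v , v∈S , x≋u+v) , x∈T) = x , x∈adjoin , x∈T , x≢0
      where
      x∈adjoin : x ∈ Subspace.Member adjoin
      x∈adjoin = let c , eq = spanning v∈S in
        1# Vector.∷ c , λ j → K.trans (K.+-cong (K.*-identityˡ (u j)) (eq j)) (K.sym (x≋u+v j))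

      x≢0 : ¬ x ≋ 0ᵛ
      x≢0 x≋0 = u∉S (respects
        (λ j → K.trans (K.+-congʳ (K.trans (K.sym (x≋0 j)) (x≋u+v j))) (y+x-x≈y (v j) (u j)))
        (-ᵛ-closed S 0-closed v∈S))

  IsAS⇒IsAAD : ∀ {n k N L} (𝓕 : Family n k N) → IsAS L 𝓕 → IsAAD L 𝓕
  IsAS⇒IsAAD 𝓕 (spread , sparse) = spread , λ i u u∉S →
    AtMost-map (λ {j} → Translate-meets⇒adjoin-meets (𝓕 i) u∉S (𝓕 j)) (sparse (adjoin (𝓕 i) u∉S))

  -- The cardinality bound with denominators cleared.

  -- The fixed member contributes the summand q^k - 1. For the others the common factor q^k cancels
  -- from `AAD-count`, because q^n - q^k = (q^(n-k) - 1) q^k.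
  AAD-bound : ∀ {n k L N} .{{_ : NonZero q}} → k ≤ n → (𝓕 : Family n k N) → IsAAD L 𝓕 →
              N * (q ^ k ∸ 1) ≤ (q ^ k ∸ 1) + L * (q ^ (n ∸ k) ∸ 1)
  AAD-bound {N = zero} k≤n 𝓕 aad = z≤n
  AAD-bound {n} {k} {L} {suc N} k≤n 𝓕 aad =
    ℕ.+-monoʳ-≤ (q ^ k ∸ 1) (ℕ.*-cancelʳ-≤ _ _ (q ^ k) {{ℕ.m^n≢0 q k}} (begin
      N * (q ^ k ∸ 1) * q ^ k          ≡⟨ ℕ.*-assoc N (q ^ k ∸ 1) (q ^ k) ⟩
      N * ((q ^ k ∸ 1) * q ^ k)        ≤⟨ AAD-count 𝓕 aad ⟩
      L * (q ^ n ∸ q ^ k)              ≡⟨ cong (L *_) q^n∸q^k ⟩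
      L * ((q ^ (n ∸ k) ∸ 1) * q ^ k)  ≡⟨ sym (ℕ.*-assoc L (q ^ (n ∸ k) ∸ 1) (q ^ k)) ⟩
      L * (q ^ (n ∸ k) ∸ 1) * q ^ k    ∎))
    where
    open ℕ.≤-Reasoning
    q^n∸q^k : q ^ n ∸ q ^ k ≡ (q ^ (n ∸ k) ∸ 1) * q ^ k
    q^n∸q^k = begin-equality
      q ^ n ∸ q ^ k                    ≡⟨ cong (λ m → q ^ m ∸ q ^ k) (sym (ℕ.m∸n+n≡m k≤n)) ⟩
      q ^ (n ∸ k + k) ∸ q ^ k          ≡⟨ cong (_∸ q ^ k) (ℕ.^-distribˡ-+-* q (n ∸ k) k) ⟩
      q ^ (n ∸ k) * q ^ k ∸ q ^ k      ≡⟨ cong (q ^ (n ∸ k) * q ^ k ∸_) (sym (ℕ.*-identityˡ (q ^ k))) ⟩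
      q ^ (n ∸ k) * q ^ k ∸ 1 * q ^ k  ≡⟨ sym (ℕ.*-distribʳ-∸ (q ^ k) (q ^ (n ∸ k)) 1) ⟩
      (q ^ (n ∸ k) ∸ 1) * q ^ k        ∎

-- Rational and asymptotic forms of the bound.

primePower⇒1<^ : ∀ {q} → IsPrimePower q → ∀ k .{{_ : NonZero k}} → 1 < q ^ k
primePower⇒1<^ q-pp k = ℕ.m∸n≢0⇒n<m (≢-nonZero⁻¹ _ {{q^k∸1≢0 q-pp k}})

primePower⇒nonZero : ∀ {q} → IsPrimePower q → NonZero q
primePower⇒nonZero {q} q-pp =
  >-nonZero (ℕ.<⇒≤ (subst (1 <_) (ℕ.^-identityʳ q) (primePower⇒1<^ q-pp 1)))

2k<n⇒k≤n : ∀ k n → 2 * k < n → k ≤ n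
2k<n⇒k≤n k n 2k<n = ℕ.<⇒≤ (ℕ.≤-<-trans (ℕ.m≤m+n k (k + 0)) 2k<n)

-- Normalised fractions hide their numerators behind a gcd, so the comparison is made between
-- unnormalised rationals, where it is a cross-multiplication.
*-bound⇒ℚ-bound : ∀ N L A B .{{_ : NonZero B}} → N * B ≤ B + L * A →
                  + N / 1 ≤ℚ 1ℚ +ℚ (+ L / 1) *ℚ (+ A / B)
*-bound⇒ℚ-bound N L A B@(suc B-1) NB≤B+LA = ℚ.toℚᵘ-cancel-≤ (begin
  toℚᵘ (+ N / 1)                                 ≃⟨ ℚ.toℚᵘ-fromℚᵘ (mkℚᵘ (+ N) 0) ⟩
  mkℚᵘ (+ N) 0                                   ≤⟨ *≤* numerators ⟩
  1ℚᵘ ℚᵘ.+ mkℚᵘ (+ L) 0 ℚᵘ.* mkℚᵘ (+ A) B-1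
    ≃⟨ ℚᵘ.+-congʳ 1ℚᵘ (ℚᵘ.*-cong (ℚ.toℚᵘ-fromℚᵘ (mkℚᵘ (+ L) 0)) (ℚ.toℚᵘ-fromℚᵘ (mkℚᵘ (+ A) B-1))) ⟨
  1ℚᵘ ℚᵘ.+ toℚᵘ (+ L / 1) ℚᵘ.* toℚᵘ (+ A / B)    ≃⟨ ℚᵘ.+-congʳ 1ℚᵘ (ℚ.toℚᵘ-homo-* (+ L / 1) (+ A / B)) ⟨
  1ℚᵘ ℚᵘ.+ toℚᵘ ((+ L / 1) *ℚ (+ A / B))         ≃⟨ ℚ.toℚᵘ-homo-+ 1ℚ ((+ L / 1) *ℚ (+ A / B)) ⟨
  toℚᵘ (1ℚ +ℚ (+ L / 1) *ℚ (+ A / B))            ∎)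
  where
  open ℚᵘ.≤-Reasoning
  numerators : + N ℤ.* + (1 * (1 * B)) ℤ.≤ (+ 1 ℤ.* + (1 * B) ℤ.+ + L ℤ.* + A ℤ.* + 1) ℤ.* + 1
  numerators = subst₂ ℤ._≤_ (ℤ.pos-* N (1 * (1 * B))) (sym rhs) (ℤ.+≤+ naturals)
    where
    rhs : (+ 1 ℤ.* + (1 * B) ℤ.+ + L ℤ.* + A ℤ.* + 1) ℤ.* + 1 ≡ + (B + L * A)
    rhs = trans (ℤ.*-identityʳ _) (cong₂ ℤ._+_
      (trans (ℤ.*-identityˡ (+ (1 * B))) (cong +_ (ℕ.*-identityˡ B)))
      (trans (ℤ.*-identityʳ _) (sym (ℤ.pos-* L A))))
    naturals : N * (1 * (1 * B)) ≤ B + L * A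
    naturals = subst (λ m → N * m ≤ B + L * A)
      (sym (trans (ℕ.*-identityˡ (1 * B)) (ℕ.*-identityˡ B))) NB≤B+LA

≤∸1+∸1 : ∀ {m} → 1 < m → m ≤ (m ∸ 1) + (m ∸ 1)
≤∸1+∸1 {suc zero}    (s≤s ())
≤∸1+∸1 {suc (suc m)} _ = s≤s (ℕ.m≤n+m (suc m) m)

-- One factor 2 comes from q^k ≤ 2 (q^k - 1); the other absorbs the summand q^k - 1 into L q^(n-k),
-- using 1 ≤ L q^(n-2k).
bound⇒≤4Lq^[n∸2k] : ∀ {q n k L N} → IsPrimePower q → .{{_ : NonZero k}} → 0 < L → 2 * k < n →
  N * (q ^ k ∸ 1) ≤ (q ^ k ∸ 1) + L * (q ^ (n ∸ k) ∸ 1) → N ≤ 4 * L * q ^ (n ∸ 2 * k)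
bound⇒≤4Lq^[n∸2k] {q} {n} {k} {L} {N} q-pp 0<L 2k<n bound =
  ℕ.*-cancelʳ-≤ _ _ Q {{ℕ.m^n≢0 q k}} (begin
    N * Q                    ≤⟨ ℕ.*-monoʳ-≤ N (≤∸1+∸1 (primePower⇒1<^ q-pp k)) ⟩
    N * (B + B)              ≡⟨ ℕ.*-distribˡ-+ N B B ⟩
    N * B + N * B            ≤⟨ ℕ.+-mono-≤ NB≤2LDQ NB≤2LDQ ⟩
    2 * X + 2 * X            ≡⟨ sym (ℕ.*-distribʳ-+ X 2 2) ⟩
    4 * X                    ≡⟨ sym (ℕ.*-assoc 4 (L * D) Q) ⟩
    4 * (L * D) * Q          ≡⟨ cong (_* Q) (sym (ℕ.*-assoc 4 L D)) ⟩
    4 * L * D * Q            ∎)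
  where
  open ℕ.≤-Reasoning
  instance
    q≢0 : NonZero q
    q≢0 = primePower⇒nonZero q-pp
  Q = q ^ k
  B = Q ∸ 1
  D = q ^ (n ∸ 2 * k)
  X = L * D * Q

  n∸k : n ∸ k ≡ (n ∸ 2 * k) + k
  n∸k = begin-equality
    n ∸ k                    ≡⟨ sym (ℕ.m∸n+n≡m (ℕ.m+n≤o⇒m≤o∸n k (ℕ.≤-trans (ℕ.≤-reflexive k+k≡2k) (ℕ.<⇒≤ 2k<n)))) ⟩
    (n ∸ k ∸ k) + k          ≡⟨ cong (_+ k) (ℕ.∸-+-assoc n k k) ⟩
    (n ∸ (k + k)) + k        ≡⟨ cong (λ m → (n ∸ m) + k) k+k≡2k ⟩
    (n ∸ 2 * k) + k          ∎
    where
    k+k≡2k : k + k ≡ 2 * k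
    k+k≡2k = cong (_+_ k) (sym (ℕ.+-identityʳ k))

  1≤LD : 1 ≤ L * D
  1≤LD = ℕ.*-mono-≤ 0<L (ℕ.m^n>0 q (n ∸ 2 * k))

  NB≤2LDQ : N * B ≤ 2 * X
  NB≤2LDQ = begin
    N * B                            ≤⟨ bound ⟩
    B + L * (q ^ (n ∸ k) ∸ 1)        ≤⟨ ℕ.+-mono-≤ (ℕ.m∸n≤m Q 1) (ℕ.*-monoʳ-≤ L (ℕ.m∸n≤m (q ^ (n ∸ k)) 1)) ⟩
    Q + L * q ^ (n ∸ k)              ≡⟨ cong₂ _+_ (sym (ℕ.*-identityˡ Q)) (cong (λ m → L * q ^ m) n∸k) ⟩
    1 * Q + L * q ^ (n ∸ 2 * k + k)  ≡⟨ cong (λ m → 1 * Q + L * m) (ℕ.^-distribˡ-+-* q (n ∸ 2 * k) k) ⟩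
    1 * Q + L * (D * Q)              ≡⟨ cong (_+_ (1 * Q)) (sym (ℕ.*-assoc L D Q)) ⟩
    1 * Q + X                        ≤⟨ ℕ.+-mono-≤ (ℕ.*-monoˡ-≤ Q 1≤LD) (ℕ.m≤m+n X 0) ⟩
    2 * X                            ∎

-- Powers, the growth of L and the exponent of AS families.

^-distribʳ-* : ∀ m n o → (m * n) ^ o ≡ m ^ o * n ^ o
^-distribʳ-* m n zero    = refl
^-distribʳ-* m n (suc o) = trans (cong (m * n *_) (^-distribʳ-* m n o))
  (ℕ.[m*n]*[o*p]≡[m*o]*[n*p] m n (m ^ o) (n ^ o))

^-cancelʳ-≤ : ∀ m n o .{{_ : NonZero o}} → m ^ o ≤ n ^ o → m ≤ n
^-cancelʳ-≤ m n o m^o≤n^o = ℕ.≮⇒≥ (λ n<m → ℕ.<⇒≱ (ℕ.^-monoˡ-< o n<m) m^o≤n^o)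

-- The upper half of L = q^o(1) without logarithms: L ≤ q^(1/b) eventually, for each b.
-- Subpolynomial and constant L both reach the exponent bound through it.
EventuallyPowersBelow : (ℕ → ℕ) → Set
EventuallyPowersBelow L = ∀ b .{{_ : NonZero b}} → ∃[ Q ] (∀ q → IsPrimePower q → Q ≤ q → L q ^ b ≤ q)

const-eventuallyPowersBelow : ∀ L → EventuallyPowersBelow (λ _ → L)
const-eventuallyPowersBelow L b = L ^ b , λ _ _ L^b≤q → L^b≤q

-- For s = a / d below 1 / b one has a b < d, so (m^b)^d = (m^d)^b ≤ q^(a b) ≤ q^d, and d-th roots
-- are taken.
≤^ℚ⇒^≤ : ∀ {m q} b .{{_ : NonZero b}} s → .{{_ : NonZero q}} → s <ℚ + 1 / b → m ≤ q ^ℚ s → m ^ b ≤ q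
≤^ℚ⇒^≤ {m} {q} b@(suc b-1) s@(mkℚ (+ a) d-1 _) s<1/b m≤q^s = ^-cancelʳ-≤ (m ^ b) q d (begin
  (m ^ b) ^ d      ≡⟨ ℕ.^-*-assoc m b d ⟩
  m ^ (b * d)      ≡⟨ cong (m ^_) (ℕ.*-comm b d) ⟩
  m ^ (d * b)      ≡⟨ sym (ℕ.^-*-assoc m d b) ⟩
  (m ^ d) ^ b      ≤⟨ ℕ.^-monoˡ-≤ b m≤q^s ⟩
  (q ^ a) ^ b      ≡⟨ ℕ.^-*-assoc q a b ⟩
  q ^ (a * b)      ≤⟨ ℕ.^-monoʳ-≤ q (ℕ.<⇒≤ ab<d) ⟩
  q ^ d            ∎)
  where
  open ℕ.≤-Reasoning
  d = suc d-1
  ab<d : a * b < d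
  ab<d = ℤ.drop‿+<+ (subst₂ ℤ._<_ (sym (ℤ.pos-* a b)) (ℤ.*-identityˡ (+ d))
    (ℚᵘ.drop-*<* (ℚᵘ.<-respʳ-≃ (ℚ.toℚᵘ-fromℚᵘ (mkℚᵘ (+ 1) b-1)) (ℚ.toℚᵘ-mono-< s<1/b))))
-- A negative exponent forces m ≤ 1.
≤^ℚ⇒^≤ {m} {q} b (mkℚ -[1+ a ] d-1 _) _ m≤q^s = begin
  m ^ b            ≤⟨ ℕ.^-monoˡ-≤ b m≤1 ⟩
  1 ^ b            ≡⟨ ℕ.^-zeroˡ b ⟩
  1                ≤⟨ >-nonZero⁻¹ q ⟩
  q                ∎
  where
  open ℕ.≤-Reasoning
  m≤1 : m ≤ 1
  m≤1 = ^-cancelʳ-≤ m 1 (suc d-1) (begin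
    m ^ suc d-1              ≤⟨ ℕ.m≤m*n (m ^ suc d-1) (q ^ suc a) {{ℕ.m^n≢0 q (suc a)}} ⟩
    m ^ suc d-1 * q ^ suc a  ≤⟨ m≤q^s ⟩
    1                        ≡⟨ sym (ℕ.^-zeroˡ (suc d-1)) ⟩
    1 ^ suc d-1              ∎)

subpolynomial⇒eventuallyPowersBelow : ∀ {L} → IsSubpolynomial L → EventuallyPowersBelow L
subpolynomial⇒eventuallyPowersBelow sub b@(suc b-1) =
  let Q , below = sub (+ 1 / b) (ℚ.positive⁻¹ (+ 1 / b) {{ℚ.normalize-pos 1 b}}) in
  Q , λ q q-pp Q≤q → let s , s<1/b , lift L≤q^s = proj₂ (below q q-pp Q≤q) in
    ≤^ℚ⇒^≤ b s {{primePower⇒nonZero q-pp}} s<1/b L≤q^s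

-- A rational a / b > d has a ≥ d b + 1, so m ≤ 4 L q^d gives m^b ≤ q^a once (4 L)^b ≤ q.
pAS-bound : ∀ {n k L} .{{_ : NonZero k}} → 2 * k < n → (∀ q → IsPrimePower q → 0 < L q) →
            EventuallyPowersBelow L → pAS n k L ≤ᵘ fromℚ (+ (n ∸ 2 * k) / 1)
pAS-bound {n} {k} {L} 2k<n 0<L L-small {r} (lift d<r)
  -- Two intermediate rationals d < r″ < r′ < r are needed: the supremum in the upper limit and the
  -- logarithm each ask for a strictly smaller witness.
  with ℚ.<-dense d<r
... | r′ , d<r′ , r′<r with ℚ.<-dense d<r′
-- A negative r″ cannot exceed d ≥ 0.
... | mkℚ -[1+ a ] b-1 _ , d<r″ , r″<r′ =
  contradiction (subst₂ ℤ._<_ (sym (ℤ.pos-* (n ∸ 2 * k) (suc b-1))) (ℤ.*-identityʳ -[1+ a ])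
    (ℚᵘ.drop-*<* (ℚᵘ.<-respˡ-≃ (ℚ.toℚᵘ-fromℚᵘ (mkℚᵘ (+ (n ∸ 2 * k)) 0)) (ℚ.toℚᵘ-mono-< d<r″)))) λ ()
... | r″@(mkℚ (+ a) b-1 _) , d<r″ , r″<r′ =
  let Q , L^2b≤q = L-small (2 * b) in
  -- Beyond this threshold both 4^(2b) and L^(2b) are at most q.
  4 ^ (2 * b) ⊔ Q , r′ , r′<r , λ 𝔽 → let open FieldBeyond 𝔽 in
    r″ , r″<r′ , lift (exponent order primePower finiteField
      (ℕ.m⊔n≤o⇒m≤o _ _ large) (L^2b≤q order primePower (ℕ.m⊔n≤o⇒n≤o (4 ^ (2 * b)) Q large)))
  where
  open ℕ.≤-Reasoning
  b = suc b-1
  d = n ∸ 2 * k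

  1+db≤a : 1 + d * b ≤ a
  1+db≤a = ℤ.drop‿+<+ (subst₂ ℤ._<_ (sym (ℤ.pos-* d b)) (ℤ.*-identityʳ (+ a))
    (ℚᵘ.drop-*<* (ℚᵘ.<-respˡ-≃ (ℚ.toℚᵘ-fromℚᵘ (mkℚᵘ (+ d) 0)) (ℚ.toℚᵘ-mono-< d<r″))))

  exponent : ∀ q (q-pp : IsPrimePower q) (F : FiniteField q) → 4 ^ (2 * b) ≤ q → L q ^ (2 * b) ≤ q →
             mAS F n k (L q) ^ b ≤ q ^ a
  exponent q q-pp F 4^2b≤q L^2b≤q = begin
    mAS F n k (L q) ^ b              ≤⟨ ℕ.^-monoˡ-≤ b m≤4Lq^d ⟩
    (4 * L q * q ^ d) ^ b            ≡⟨ ^-distribʳ-* (4 * L q) (q ^ d) b ⟩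
    (4 * L q) ^ b * (q ^ d) ^ b      ≤⟨ ℕ.*-mono-≤ [4L]^b≤q (ℕ.≤-reflexive (ℕ.^-*-assoc q d b)) ⟩
    q * q ^ (d * b)                  ≤⟨ ℕ.^-monoʳ-≤ q 1+db≤a ⟩
    q ^ a                            ∎
    where
    instance
      q≢0 : NonZero q
      q≢0 = primePower⇒nonZero q-pp

    m≤4Lq^d : mAS F n k (L q) ≤ 4 * L q * q ^ d
    m≤4Lq^d = let 𝓕 , as = proj₁ (proj₂ (Families.maxAS F n k (L q))) in
      bound⇒≤4Lq^[n∸2k] {k = k} q-pp (0<L q q-pp) 2k<n
        (AAD-bound F (2k<n⇒k≤n k n 2k<n) 𝓕 (IsAS⇒IsAAD F 𝓕 as))

    -- Bounding both factors of 4 L by their maximum gives (4 L)^b ≤ M^(2b), and M is 4 or L; this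
    -- avoids square roots of q.
    M = 4 ⊔ L q

    M^2b≤q : M ^ (2 * b) ≤ q
    M^2b≤q with ℕ.⊔-sel 4 (L q)
    ... | inj₁ eq = subst (λ m → m ^ (2 * b) ≤ q) (sym eq) 4^2b≤q
    ... | inj₂ eq = subst (λ m → m ^ (2 * b) ≤ q) (sym eq) L^2b≤q

    [4L]^b≤q : (4 * L q) ^ b ≤ q
    [4L]^b≤q = begin
      (4 * L q) ^ b  ≤⟨ ℕ.^-monoˡ-≤ b (ℕ.*-mono-≤ (ℕ.m≤m⊔n 4 (L q))
                          (ℕ.≤-trans (ℕ.m≤n⊔m 4 (L q)) (ℕ.≤-reflexive (sym (ℕ.*-identityʳ M))))) ⟩
      (M ^ 2) ^ b    ≡⟨ ℕ.^-*-assoc M 2 b ⟩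
      M ^ (2 * b)    ≤⟨ M^2b≤q ⟩
      q              ∎

theorem1 : (∀ (n k L : ℕ) .{{_ : NonZero k}} → 0 < L → 2 * k < n →
    ∀ (q : ℕ) (q-pp : IsPrimePower q) (F : FiniteField q) → let open Families F in
    ∀ (N : ℕ) (𝓕 : Family n k N) → IsAAD L 𝓕 →
    + N / 1 ≤ℚ 1ℚ +ℚ (+ L / 1) *ℚ ((+ (q ^ (n ∸ k) ∸ 1) / (q ^ k ∸ 1)) {{q^k∸1≢0 q-pp k}}))
    × (∀ (n k : ℕ) .{{_ : NonZero k}} → 2 * k < n →
    ∀ (L : ℕ → ℕ) → (∀ q → IsPrimePower q → 0 < L q) → IsSubpolynomial L →
    pAS n k L ≤ᵘ fromℚ (+ (n ∸ 2 * k) / 1))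
    × (∀ (n k L : ℕ) .{{_ : NonZero k}} → 2 * k < n → 0 < L →
    pAS n k (λ _ → L) ≤ᵘ fromℚ (+ (n ∸ 2 * k) / 1))
theorem1 =
    (λ n k L _ 2k<n q q-pp F N 𝓕 aad →
       *-bound⇒ℚ-bound N L (q ^ (n ∸ k) ∸ 1) (q ^ k ∸ 1) {{q^k∸1≢0 q-pp k}}
         (AAD-bound F {{primePower⇒nonZero q-pp}} (2k<n⇒k≤n k n 2k<n) 𝓕 aad))
  , (λ n k 2k<n L 0<L sub → pAS-bound 2k<n 0<L (subpolynomial⇒eventuallyPowersBelow sub))
  , (λ n k L 2k<n 0<L → pAS-bound 2k<n (λ _ _ → 0<L) (const-eventuallyPowersBelow L))
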